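{- For all integers $s\ge3$ and $k\ge2$ there are infinitely many pairwise non-isomorphic connected graphs $G\in\mathcal G^s_1$ with $v(G)\neq k$ such that $\tau_k(G)=\dfrac{v(G)-k}{sk-k+1}$.
   Context: All graphs are finite and simple. For integers $1\le r\le s$, $\mathcal G^s_r$ denotes the set of graphs in which every vertex has degree at least $r$ and at most $s$. $v(G)$ is the number of vertices of $G$. For an integer $k\ge1$, $\tau_k(G)$ denotes the maximum number of pairwise vertex-disjoint subgraphs of $G$ each of which is a tree with exactly $k$ edges. -}

module Defs where

open import Data.Fin using (Fin; zero; suc; inject₁; fromℕ; _<?_)
open import Data.Fin.Subset using (Subset; _∈_; _∩_; ⊤; Nonempty; Empty)
open import Data.List using (length; filter; cartesianProduct; allFin)
open import Data.Nat using (ℕ; _+_; _≤_)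
open import Data.Product using (Σ-syntax; _×_; _,_)
open import Function.Bundles using (_↔_; _⇔_; Inverse)
open import Function.Definitions using (Injective)
open import Level using (0ℓ)
open import Relation.Binary using (Rel; Symmetric; Irreflexive; Decidable)
open import Relation.Binary.Construct.Closure.ReflexiveTransitive using (Star)
open import Relation.Binary.PropositionalEquality using (_≡_; _≢_)
open import Relation.Nullary using (¬_)
open import Relation.Nullary.Decidable using (_×-dec_)

record Graph : Set₁ where
  field
    v      : ℕ
    _~_    : Rel (Fin v) 0ℓ
    _~?_   : Decidable _~_
    sym    : Symmetric _~_
    irrefl : Irreflexive _≡_ _~_

open Graph public using (v)

record _≅_ (G H : Graph) : Set where
  private
    module G = Graph G
    module H = Graph H
  field
    bij      : Fin G.v ↔ Fin H.v
    adjacent : ∀ x y → (x G.~ y) ⇔ (Inverse.to bij x H.~ Inverse.to bij y)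

degree : (G : Graph) → Fin (v G) → ℕ
degree G x = length (filter (x ~?_) (allFin _))
  where open Graph G

-- 𝒢 r s G means G ∈ 𝒢ˢᵣ.
𝒢 : ℕ → ℕ → Graph → Set
𝒢 r s G = ∀ x → r ≤ degree G x × degree G x ≤ s

-- Connectedness of the graph with vertex set V and adjacency E, where E only
-- relates elements of V, so that walks stay inside V.  The empty graph is not
-- connected.
IsConnected : ∀ {n} → Subset n → Rel (Fin n) 0ℓ → Set
IsConnected V E = Nonempty V × (∀ {x y} → x ∈ V → y ∈ V → Star E x y)

-- A cycle is a sequence of 3 + m distinct vertices c 0, …, c (2 + m) with
-- consecutive ones adjacent and the last one adjacent to the first.
IsAcyclic : ∀ {n} → Rel (Fin n) 0ℓ → Set
IsAcyclic {n} E = ∀ m (c : Fin (3 + m) → Fin n) → Injective _≡_ _≡_ c →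
  ¬ ((∀ i → E (c (inject₁ i)) (c (suc i))) × E (c (fromℕ (2 + m))) (c zero))

Connected : Graph → Set
Connected G = IsConnected ⊤ (Graph._~_ G)

-- Not necessarily induced.
record Subgraph (G : Graph) : Set₁ where
  open Graph G using (_~_)
  field
    vertices : Subset (v G)
    edge     : Rel (Fin (v G)) 0ℓ
    edge?    : Decidable edge
    edge-sym : Symmetric edge
    edge⇒~   : ∀ {x y} → edge x y → x ~ y
    edge⇒∈   : ∀ {x y} → edge x y → x ∈ vertices

open Subgraph public using (vertices)

IsTree : ∀ {G} → Subgraph G → Set
IsTree H = IsConnected (Subgraph.vertices H) (Subgraph.edge H) × IsAcyclic (Subgraph.edge H)

-- Each edge {x , y} is counted once, as the pair with x < y.
edgeCount : ∀ {G} → Subgraph G → ℕ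
edgeCount H = length (filter (λ (x , y) → (x <? y) ×-dec edge? x y)
                             (cartesianProduct (allFin _) (allFin _)))
  where open Subgraph H

TreePacking : ℕ → Graph → ℕ → Set₁
TreePacking k G t = Σ[ T ∈ (Fin t → Subgraph G) ]
  (∀ i → IsTree (T i) × edgeCount (T i) ≡ k) ×
  (∀ i j → i ≢ j → Empty (vertices (T i) ∩ vertices (T j)))

-- τ k ⟨ G ⟩≐ t means τₖ(G) = t; a maximum is unique, so this determines t.
τ_⟨_⟩≐_ : ℕ → Graph → ℕ → Set₁
τ k ⟨ G ⟩≐ t = TreePacking k G t × (∀ t′ → TreePacking k G t′ → t′ ≤ t)

{-# OPTIONS --safe #-}
-- Take t centres and 1 + t (s - 1) disjoint paths with k vertices each, and join
-- the i-th centre to the first vertices of the paths i (s - 1), …, (i + 1) (s - 1),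
-- so that consecutive centres share one path.  Deleting the centres leaves paths
-- with k - 1 edges, hence every tree with k edges contains a centre and
-- τₖ ≤ t.  Conversely, the i-th centre together with the path i (s - 1) is a tree
-- with k edges, and these t trees are disjoint.
module Submission where

open import Defs
open import Data.Nat using (ℕ; suc; _*_; _∸_; _≤_)
open import Data.Integer using (+_; _-_)
open import Data.Rational using (_/_)
open import Data.Product using (Σ-syntax; ∃-syntax; _×_)
open import Relation.Binary.PropositionalEquality using (_≡_; _≢_)
open import Relation.Nullary using (¬_)

import Data.Integer as ℤ
import Data.Integer.Properties as ℤ
import Data.Nat.DivMod as ℕ
import Data.Rational.Properties as ℚ
import Data.Rational.Unnormalised as ℚᵘ
open import Data.Fin as Fin using (Fin; zero; suc; toℕ; fromℕ; fromℕ<; inject₁; combine; remQuot; _↑ˡ_; _↑ʳ_)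
open import Data.Fin.Induction using (<-weakInduction)
open import Data.Fin.Permutation using (↔⇒≡)
open import Data.Fin.Properties as Fin using (any?; toℕ-injective; toℕ-inject₁; toℕ-fromℕ<; toℕ<n)
open import Data.Fin.Relation.Unary.Top using (view; ‵fromℕ; ‵inject₁)
open import Data.Fin.Subset using (Subset; _∈_)
open import Data.Fin.Subset.Properties using (_∈?_; ∈⊤; x∈p∩q⁺; x∈p∩q⁻)
open import Data.List using (List; length; lookup; allFin; cartesianProduct)
open import Data.List.Extrema.Nat using (argmax; f[xs]≤f[argmax])
open import Data.List.Membership.Propositional using () renaming (_∈_ to _∈ₗ_)
open import Data.List.Membership.Propositional.Properties
  using (∈-lookup; ∈-allFin; ∈-filter⁺; ∈-filter⁻; ∈-cartesianProduct⁺)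
open import Data.List.Relation.Unary.All as All using ()
open import Data.List.Relation.Unary.AllPairs using (_∷_)
open import Data.List.Relation.Unary.Any using (index)
open import Data.List.Relation.Unary.Any.Properties using (lookup-index)
open import Data.List.Relation.Unary.Unique.Propositional using (Unique)
open import Data.List.Relation.Unary.Unique.Propositional.Properties using (allFin⁺; filter⁺; cartesianProduct⁺)
open import Data.Nat as ℕ using (zero; _+_; _<_; z≤n; s≤s; s<s; pred; NonZero; >-nonZero)
open import Data.Nat.Properties as ℕ
open import Data.Nat.Solver using (module +-*-Solver)
open import Data.Product using (∃; _,_; proj₁; proj₂; uncurry)
open import Data.Sum using (_⊎_; inj₁; inj₂; swap)
open import Data.Vec as Vec using (tabulate; _∷_; [])
open import Data.Vec.Properties using (lookup∘tabulate; lookup⇒[]=; []=⇒lookup)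
open import Function using (_∘_; id; case_of_)
open import Function.Definitions using (Injective)
open import Relation.Binary.Core using (Rel)
open import Relation.Binary.Definitions using (Decidable; Symmetric; tri<; tri≈; tri>)
open import Relation.Binary.Construct.Closure.ReflexiveTransitive using (Star; ε; _◅_; _◅◅_; gmap; reverse)
open import Relation.Binary.PropositionalEquality using (refl; sym; trans; cong; cong₂; subst; subst₂; module ≡-Reasoning)
open import Relation.Nullary.Decidable using (Dec; yes; no; does; map′; dec-true; _×-dec_; _⊎-dec_)
open import Relation.Nullary.Negation using (contradiction)
open import Level using (0ℓ)

-- Counting by duplicate-free lists: bounds for degrees and edge numbers.

lookup-injective : ∀ {A : Set} {xs : List A} → Unique xs →
  ∀ i j → lookup xs i ≡ lookup xs j → i ≡ j
lookup-injective (_  ∷ _) zero    zero    _  = refl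
lookup-injective (x∉ ∷ _) zero    (suc j) eq = contradiction eq (All.lookup x∉ (∈-lookup j))
lookup-injective (x∉ ∷ _) (suc i) zero    eq = contradiction (sym eq) (All.lookup x∉ (∈-lookup i))
lookup-injective (_  ∷ u) (suc i) (suc j) eq = cong suc (lookup-injective u i j eq)

-- Choosing a covering index for each position of `xs` is injective, because `h` is injective and
-- `xs` has no repetitions.
covered⇒length≤ : ∀ {A B : Set} {xs : List A} {n} → Unique xs →
  (h : A → B) → Injective _≡_ _≡_ h → (g : Fin n → B) →
  (∀ {x} → x ∈ₗ xs → ∃ λ j → h x ≡ g j) → length xs ≤ n
covered⇒length≤ {xs = xs} uniq h h-inj g cover = Fin.injective⇒≤ {f = f} f-inj
  where
  f = λ i → proj₁ (cover (∈-lookup {xs = xs} i))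
  f-inj : Injective _≡_ _≡_ f
  f-inj {i} {j} fi≡fj = lookup-injective uniq i j (h-inj
    (trans (proj₂ (cover (∈-lookup i))) (trans (cong g fi≡fj) (sym (proj₂ (cover (∈-lookup j)))))))

injective⇒≤length : ∀ {A : Set} {xs : List A} {n} (g : Fin n → A) → Injective _≡_ _≡_ g →
  (∀ j → g j ∈ₗ xs) → n ≤ length xs
injective⇒≤length {xs = xs} g g-inj g∈ = Fin.injective⇒≤ {f = λ j → index (g∈ j)}
  λ {i} {j} eq → g-inj (trans (lookup-index (g∈ i)) (trans (cong (lookup xs) eq) (sym (lookup-index (g∈ j)))))

module _ (G : Graph) where
  open Graph G

  -- Neighbours are covered by natural numbers instead of vertices, so `g` may contain repetitions
  -- and values that are not the number of any vertex.
  degree≤ : ∀ {n} x (g : Fin n → ℕ) → (∀ y → x ~ y → ∃ λ j → toℕ y ≡ g j) → degree G x ≤ n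
  degree≤ x g cover = covered⇒length≤ (filter⁺ (x ~?_) (allFin⁺ _)) toℕ toℕ-injective g
    λ y∈ → cover _ (proj₂ (∈-filter⁻ (x ~?_) {xs = allFin _} y∈))

  1≤degree : ∀ x y → x ~ y → 1 ≤ degree G x
  1≤degree x y x~y = injective⇒≤length (λ (_ : Fin 1) → y) (λ { {zero} {zero} _ → refl })
    λ _ → ∈-filter⁺ (x ~?_) (∈-allFin y) x~y

module _ {G : Graph} (H : Subgraph G) where
  open Subgraph H

  private
    increasing? : (xy : Fin (v G) × Fin (v G)) → Dec (proj₁ xy Fin.< proj₂ xy × edge (proj₁ xy) (proj₂ xy))
    increasing? (x , y) = (x Fin.<? y) ×-dec edge? x y

  edgeCount≤ : ∀ {n} (g : Fin n → Fin (v G) × Fin (v G)) →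
    (∀ x y → x Fin.< y → edge x y → ∃ λ j → (x , y) ≡ g j) → edgeCount H ≤ n
  edgeCount≤ g cover =
    covered⇒length≤ (filter⁺ increasing? (cartesianProduct⁺ (allFin⁺ _) (allFin⁺ _))) id id g
      λ {(x , y)} xy∈ → uncurry (cover x y) (proj₂
        (∈-filter⁻ increasing? {xs = cartesianProduct (allFin _) (allFin _)} xy∈))

  ≤edgeCount : ∀ {n} (g : Fin n → Fin (v G) × Fin (v G)) → Injective _≡_ _≡_ g →
    (∀ j → proj₁ (g j) Fin.< proj₂ (g j) × edge (proj₁ (g j)) (proj₂ (g j))) → n ≤ edgeCount H
  ≤edgeCount g g-inj g-edge = injective⇒≤length g g-inj λ j →
    ∈-filter⁺ increasing? (∈-cartesianProduct⁺ (∈-allFin _) (∈-allFin _)) (g-edge j)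

-- Cycles and a criterion for acyclicity.

-- The two positions are the cyclic predecessor and successor; they differ because a cycle has at
-- least three vertices. The wrap-around cases are the first and the last position.
cycle-neighbours : ∀ {n} {E : Rel (Fin n) 0ℓ} → Symmetric E → ∀ m (c : Fin (3 + m) → Fin n) →
  (∀ i → E (c (inject₁ i)) (c (suc i))) → E (c (fromℕ (2 + m))) (c zero) →
  ∀ i → ∃ λ p → ∃ λ q → p ≢ q × E (c p) (c i) × E (c q) (c i)
cycle-neighbours E-sym m c next close zero = fromℕ (2 + m) , suc zero , (λ ()) , close , E-sym (next zero)
cycle-neighbours E-sym m c next close (suc j) with view j
... | ‵fromℕ      = inject₁ j , zero , (λ ()) , next j , E-sym close
... | ‵inject₁ j′ = inject₁ (inject₁ j′) , suc (suc j′) ,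
                    -- With `{1}` the library fact says that a number differs from itself plus two.
                    (λ eq → m≢1+n+m (toℕ j′) {1} (trans (sym (trans (toℕ-inject₁ _) (toℕ-inject₁ j′))) (cong toℕ eq))) ,
                    next j , E-sym (next (suc j′))

abstract
  maximum : ∀ {n} (f : Fin (suc n) → ℕ) → ∃ λ i → ∀ j → f j ≤ f i
  maximum {n} f = argmax f zero (allFin (suc n)) ,
    λ j → All.lookup (f[xs]≤f[argmax] {f = f} zero (allFin (suc n))) (∈-allFin j)

-- A vertex of a cycle on which f is maximal has two neighbours on the cycle where f is not larger.
acyclic : ∀ {n} {E : Rel (Fin n) 0ℓ} → Symmetric E → (f : Fin n → ℕ) →
  (∀ {x y z} → E x y → E z y → f x ≤ f y → f z ≤ f y → x ≡ z) → IsAcyclic E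
acyclic {E = E} E-sym f unique m c c-inj (next , close) =
  let top , ≤-top = maximum (f ∘ c)
      p , q , p≢q , Epi , Eqi = cycle-neighbours {E = E} E-sym m c next close top
  in p≢q (c-inj (unique Epi Eqi (≤-top p) (≤-top q)))

-- Increasing paths as tree subgraphs.

module _ {n} {P : Fin n → Set} (P? : ∀ x → Dec (P x)) where
  comprehension : Subset n
  comprehension = tabulate (λ x → does (P? x))

  ∈-comprehension⁺ : ∀ {x} → P x → x ∈ comprehension
  ∈-comprehension⁺ {x} px = lookup⇒[]= x _ (trans (lookup∘tabulate _ x) (dec-true (P? x) px))

  ∈-comprehension⁻ : ∀ {x} → x ∈ comprehension → P x
  ∈-comprehension⁻ {x} x∈ with P? x | trans (sym (lookup∘tabulate (λ y → does (P? y)) x)) ([]=⇒lookup x∈)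
  ... | yes px | _ = px
  ... | no _   | ()

module IncreasingPath (G : Graph) {k : ℕ} (w : Fin (suc k) → Fin (v G))
  (w-mono : ∀ {i j} → i Fin.< j → w i Fin.< w j)
  (w-adjacent : ∀ j → Graph._~_ G (w (inject₁ j)) (w (suc j))) where

  -- Monotonicity of `w` makes the vertex order an orientation of the path. It yields injectivity of
  -- `w`, it matches the pairs `x < y` counted by `edgeCount`, and it lets `toℕ` serve as the
  -- function that `acyclic` asks for.
  _⟶_ : Rel (Fin (v G)) 0ℓ
  x ⟶ y = ∃ λ j → w (inject₁ j) ≡ x × w (suc j) ≡ y

  ⟶⇒< : ∀ {x y} → x ⟶ y → x Fin.< y
  ⟶⇒< (j , refl , refl) = w-mono (s≤s (≤-reflexive (toℕ-inject₁ j)))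

  w-injective : Injective _≡_ _≡_ w
  w-injective {i} {j} eq with <-cmp (toℕ i) (toℕ j)
  ... | tri< i<j _ _ = contradiction (cong toℕ eq) (<⇒≢ (w-mono i<j))
  ... | tri≈ _ i≡j _ = toℕ-injective i≡j
  ... | tri> _ _ j<i = contradiction (cong toℕ (sym eq)) (<⇒≢ (w-mono j<i))

  -- Injectivity of `w` forces equal indices. In `acyclic` this excludes two distinct neighbours
  -- below the largest vertex of a cycle.
  ⟶-unique : ∀ {x y z} → x ⟶ y → z ⟶ y → x ≡ z
  ⟶-unique (i , refl , refl) (j , refl , eq) =
    cong (w ∘ inject₁) (sym (Fin.suc-injective (w-injective eq)))

  E : Rel (Fin (v G)) 0ℓ
  E x y = x ⟶ y ⊎ y ⟶ x

  ≤⇒⟶ : ∀ {x y} → E x y → x Fin.≤ y → x ⟶ y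
  ≤⇒⟶ (inj₁ x⟶y) _   = x⟶y
  ≤⇒⟶ (inj₂ y⟶x) x≤y = contradiction x≤y (<⇒≱ (⟶⇒< y⟶x))

  _⟶?_ : Decidable _⟶_
  x ⟶? y = any? λ j → (w (inject₁ j) Fin.≟ x) ×-dec (w (suc j) Fin.≟ y)

  onPath? : ∀ x → Dec (∃ λ j → w j ≡ x)
  onPath? x = any? λ j → w j Fin.≟ x

  path : Subgraph G
  path = record
    { vertices = comprehension onPath?
    ; edge     = E
    ; edge?    = λ x y → (x ⟶? y) ⊎-dec (y ⟶? x)
    ; edge-sym = swap
    ; edge⇒~   = λ where
        (inj₁ (j , refl , refl)) → w-adjacent j
        (inj₂ (j , refl , refl)) → Graph.sym G (w-adjacent j)
    ; edge⇒∈   = λ where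
        (inj₁ (j , eq , _)) → ∈-comprehension⁺ onPath? (inject₁ j , eq)
        (inj₂ (j , _ , eq)) → ∈-comprehension⁺ onPath? (suc j , eq)
    }

  w∈path : ∀ j → w j ∈ vertices path
  w∈path j = ∈-comprehension⁺ onPath? (j , refl)

  ∈path⇒w : ∀ {x} → x ∈ vertices path → ∃ λ j → w j ≡ x
  ∈path⇒w = ∈-comprehension⁻ onPath?

  from-start : ∀ j → Star E (w zero) (w j)
  from-start = <-weakInduction (λ j → Star E (w zero) (w j)) ε
    λ j walk → walk ◅◅ inj₁ (j , refl , refl) ◅ ε

  path-isTree : IsTree path
  path-isTree = ((w zero , w∈path zero) , connected) ,
    acyclic swap toℕ λ Exy Ezy x≤y z≤y → ⟶-unique (≤⇒⟶ Exy x≤y) (≤⇒⟶ Ezy z≤y)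
    where
    connected : ∀ {x y} → x ∈ vertices path → y ∈ vertices path → Star E x y
    connected x∈ y∈ with ∈path⇒w x∈ | ∈path⇒w y∈
    ... | i , refl | j , refl = reverse swap (from-start i) ◅◅ from-start j

  edgeCount-path : edgeCount path ≡ k
  edgeCount-path = ≤-antisym
    (edgeCount≤ path steps λ x y x<y Exy → case ≤⇒⟶ Exy (<⇒≤ x<y) of λ where
      (j , refl , refl) → j , refl)
    (≤edgeCount path steps (Fin.suc-injective ∘ w-injective ∘ cong proj₂)
      λ j → ⟶⇒< (j , refl , refl) , inj₁ (j , refl , refl))
    where
    steps : Fin k → Fin (v G) × Fin (v G)
    steps j = w (inject₁ j) , w (suc j)

-- The graph has 1 + t′ centres of degree 1 + d, and paths with 1 + k′ vertices.
module Caterpillar (d k′ t′ : ℕ) (2≤d : 2 ≤ d) where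

  private
    k t m size : ℕ
    k = suc k′
    t = suc t′
    m = suc (t * d)
    size = t + m * k

    instance
      d≢0 : NonZero d
      d≢0 = >-nonZero (≤-trans (s≤s z≤n) 2≤d)

  -- The graph: vertices, their numbering and adjacency.

  V : Set
  V = Fin t ⊎ (Fin m × Fin k)

  pattern centre i  = inj₁ i
  pattern onPath q l = inj₂ (q , l)

  decode : Fin size → V
  decode x with Fin.splitAt t x
  ... | inj₁ i = centre i
  ... | inj₂ y = inj₂ (remQuot k y)

  encode : V → Fin size
  encode (centre i)   = i ↑ˡ (m * k)
  encode (onPath q l) = t ↑ʳ combine q l

  decode-encode : ∀ a → decode (encode a) ≡ a
  decode-encode (centre i) rewrite Fin.splitAt-↑ˡ t i (m * k) = refl
  decode-encode (onPath q l) rewrite Fin.splitAt-↑ʳ t (m * k) (combine q l) = cong inj₂ (Fin.remQuot-combine q l)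

  encode-decode : ∀ x → encode (decode x) ≡ x
  encode-decode x with Fin.splitAt t x | Fin.join-splitAt t (m * k) x
  ... | inj₁ i | eq = eq
  ... | inj₂ y | eq = trans (cong (t ↑ʳ_) (Fin.combine-remQuot {m} k y)) eq

  encode≡ : ∀ {x a} → decode x ≡ a → x ≡ encode a
  encode≡ {x} refl = sym (encode-decode x)

  -- Centres come first, then the paths one after another, each from its attached end outwards. With
  -- this numbering every edge `a ⋖ b` goes upwards, so the packed trees are increasing paths.
  code : V → ℕ
  code (centre i)   = toℕ i
  code (onPath q l) = t + (k * toℕ q + toℕ l)

  toℕ-encode : ∀ a → toℕ (encode a) ≡ code a
  toℕ-encode (centre i)   = Fin.toℕ-↑ˡ i (m * k)
  toℕ-encode (onPath q l) = trans (Fin.toℕ-↑ʳ t (combine q l)) (cong (_+_ t) (Fin.toℕ-combine q l))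

  toℕ≡code : ∀ x → toℕ x ≡ code (decode x)
  toℕ≡code x = trans (cong toℕ (sym (encode-decode x))) (toℕ-encode (decode x))

  -- Both bounds of `attach` are inclusive: a centre gets `1 + d` paths, and the last path of one
  -- centre is the first path of the next. In `step` the positions are variables related through
  -- `toℕ`, so that matching never has to unify with `inject₁`.
  data _⋖_ : Rel V 0ℓ where
    attach : ∀ {i q} → toℕ i * d ≤ toℕ q → toℕ q ≤ toℕ i * d + d → centre i ⋖ onPath q zero
    step   : ∀ {q l l′} → toℕ l′ ≡ suc (toℕ l) → onPath q l ⋖ onPath q l′

  _⋖?_ : Decidable _⋖_
  centre i   ⋖? centre j         = no λ ()
  centre i   ⋖? onPath q zero    = map′ (uncurry attach) (λ { (attach p q) → p , q })
                                     ((toℕ i * d ≤? toℕ q) ×-dec (toℕ q ≤? toℕ i * d + d))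
  centre i   ⋖? onPath q (suc l) = no λ ()
  onPath q l ⋖? centre i         = no λ ()
  onPath q l ⋖? onPath q′ l′     = map′ (λ { (refl , eq) → step eq }) (λ { (step eq) → refl , eq })
                                     ((q Fin.≟ q′) ×-dec (toℕ l′ ℕ.≟ suc (toℕ l)))

  centre<onPath : ∀ i q l → code (centre i) < code (onPath q l)
  centre<onPath i q l = <-≤-trans (toℕ<n i) (m≤m+n t _)

  onPath-mono : ∀ q {l l′} → l Fin.< l′ → code (onPath q l) < code (onPath q l′)
  onPath-mono q l<l′ = +-monoʳ-< t (+-monoʳ-< (k * toℕ q) l<l′)

  ⋖⇒code< : ∀ {a b} → a ⋖ b → code a < code b
  ⋖⇒code< (attach {i} {q} _ _) = centre<onPath i q zero
  ⋖⇒code< (step {q} eq)        = onPath-mono q (≤-reflexive (sym eq))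

  encode-mono : ∀ a b → code a < code b → encode a Fin.< encode b
  encode-mono a b = subst₂ _<_ (sym (toℕ-encode a)) (sym (toℕ-encode b))

  Adj : Rel V 0ℓ
  Adj a b = a ⋖ b ⊎ b ⋖ a

  Adj-irrefl : ∀ {a} → ¬ Adj a a
  Adj-irrefl (inj₁ a⋖a) = <-irrefl refl (⋖⇒code< a⋖a)
  Adj-irrefl (inj₂ a⋖a) = <-irrefl refl (⋖⇒code< a⋖a)

  graph : Graph
  graph = record
    { v      = size
    ; _~_    = λ x y → Adj (decode x) (decode y)
    ; _~?_   = λ x y → (decode x ⋖? decode y) ⊎-dec (decode y ⋖? decode x)
    ; sym    = swap
    ; irrefl = λ { refl → Adj-irrefl }
    }

  open Graph graph using (_~_)

  Adj⇒~ : ∀ {a b} → Adj a b → encode a ~ encode b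
  Adj⇒~ {a} {b} = subst₂ Adj (sym (decode-encode a)) (sym (decode-encode b))

  <⇒⋖ : ∀ {x y} → x Fin.< y → x ~ y → decode x ⋖ decode y
  <⇒⋖ _ (inj₁ x⋖y) = x⋖y
  <⇒⋖ {x} {y} x<y (inj₂ y⋖x) =
    contradiction (subst₂ _<_ (sym (toℕ≡code y)) (sym (toℕ≡code x)) (⋖⇒code< y⋖x)) (<⇒≯ x<y)

  -- Anchors and connectedness.

  anchor-bound : ∀ (i : Fin t) → toℕ i * d < m
  anchor-bound i = s≤s (*-monoˡ-≤ d (<⇒≤ (toℕ<n i)))

  -- The first path of the interval of a centre has two uses: it links the centre to the preceding
  -- one, if any, and it completes the tree packed at this centre.
  anchor : Fin t → Fin m
  anchor i = fromℕ< (anchor-bound i)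

  toℕ-anchor : ∀ i → toℕ (anchor i) ≡ toℕ i * d
  toℕ-anchor i = toℕ-fromℕ< (anchor-bound i)

  anchor-injective : Injective _≡_ _≡_ anchor
  anchor-injective {i} {j} eq = toℕ-injective (*-cancelʳ-≡ (toℕ i) (toℕ j) d
    (trans (sym (toℕ-anchor i)) (trans (cong toℕ eq) (toℕ-anchor j))))

  centre⋖anchor : ∀ i → centre i ⋖ onPath (anchor i) zero
  centre⋖anchor i = attach (≤-reflexive (sym (toℕ-anchor i))) (≤-trans (≤-reflexive (toℕ-anchor i)) (m≤m+n _ d))

  previous⋖anchor : ∀ (i : Fin t′) → centre (inject₁ i) ⋖ onPath (anchor (suc i)) zero
  previous⋖anchor i = attach
    (begin
      toℕ (inject₁ i) * d        ≡⟨ cong (_* d) (toℕ-inject₁ i) ⟩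
      toℕ i * d                  ≤⟨ m≤n+m _ d ⟩
      suc (toℕ i) * d            ≡⟨ sym (toℕ-anchor (suc i)) ⟩
      toℕ (anchor (suc i))       ∎)
    (begin
      toℕ (anchor (suc i))       ≡⟨ toℕ-anchor (suc i) ⟩
      d + toℕ i * d              ≡⟨ +-comm d _ ⟩
      toℕ i * d + d              ≡⟨ cong (λ n → n * d + d) (sym (toℕ-inject₁ i)) ⟩
      toℕ (inject₁ i) * d + d    ∎)
    where open ≤-Reasoning

  -- After path 0 is set aside, the remaining `t * d` paths fall into `t` blocks of length `d`.
  -- Division with remainder finds the block, and the shift by one keeps the very last path with the
  -- last centre.
  owner : ∀ q → ∃ λ i → centre i ⋖ onPath q zero
  owner zero    = zero , attach z≤n z≤n
  owner (suc q) with Fin.combine-surjective {t} {d} q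
  ... | i , r , refl = i , attach
    (begin
      toℕ i * d                 ≡⟨ *-comm (toℕ i) d ⟩
      d * toℕ i                 ≤⟨ m≤m+n _ (toℕ r) ⟩
      d * toℕ i + toℕ r         ≡⟨ sym (Fin.toℕ-combine i r) ⟩
      toℕ (combine i r)         ≤⟨ n≤1+n _ ⟩
      suc (toℕ (combine i r))   ∎)
    (begin
      suc (toℕ (combine i r))   ≡⟨ cong suc (Fin.toℕ-combine i r) ⟩
      suc (d * toℕ i + toℕ r)   ≡⟨ sym (+-suc _ _) ⟩
      d * toℕ i + suc (toℕ r)   ≤⟨ +-mono-≤ (≤-reflexive (*-comm d (toℕ i))) (toℕ<n r) ⟩
      toℕ i * d + d             ∎)
    where open ≤-Reasoning

  step-inject₁ : ∀ q (l : Fin k′) → onPath q (inject₁ l) ⋖ onPath q (suc l)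
  step-inject₁ q l = step (cong suc (sym (toℕ-inject₁ l)))

  -- Consecutive centres are two steps apart, through the first vertex of their shared path.
  reach-centre : ∀ i → Star Adj (centre zero) (centre i)
  reach-centre = <-weakInduction (λ i → Star Adj (centre zero) (centre i)) ε
    λ i walk → walk ◅◅ inj₁ (previous⋖anchor i) ◅ inj₂ (centre⋖anchor (suc i)) ◅ ε

  reach-onPath : ∀ q l → Star Adj (centre zero) (onPath q l)
  reach-onPath q = <-weakInduction (λ l → Star Adj (centre zero) (onPath q l))
    (reach-centre (proj₁ (owner q)) ◅◅ inj₁ (proj₂ (owner q)) ◅ ε)
    λ l walk → walk ◅◅ inj₁ (step-inject₁ q l) ◅ ε

  reach : ∀ a → Star Adj (centre zero) a
  reach (centre i)   = reach-centre i
  reach (onPath q l) = reach-onPath q l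

  graph-connected : Connected graph
  graph-connected = (zero , ∈⊤) , λ {x} {y} _ _ →
    subst₂ (Star _~_) (encode-decode x) (encode-decode y)
      (gmap encode Adj⇒~ (reverse swap (reach (decode x)) ◅◅ reach (decode y)))

  -- Degree bounds.

  neighbour : ∀ a → ∃ λ b → Adj a b
  neighbour (centre i)         = _ , inj₁ (centre⋖anchor i)
  neighbour (onPath q zero)    = _ , inj₂ (proj₂ (owner q))
  neighbour (onPath q (suc l)) = _ , inj₂ (step-inject₁ q l)

  graph-degree≥1 : ∀ x → 1 ≤ degree graph x
  graph-degree≥1 x =
    1≤degree graph x (encode b) (subst (_~ encode b) (encode-decode x) (Adj⇒~ (proj₂ (neighbour (decode x)))))
    where b = proj₁ (neighbour (decode x))

  -- The trailing `+ 0` is the position of the attached vertex on its path; it makes the value agree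
  -- with `code` by computation.
  centre-codes : Fin t → Fin (suc d) → ℕ
  centre-codes i j = t + (k * (toℕ i * d + toℕ j) + 0)

  -- The first two entries bound the centres whose interval i d, …, i d + d contains q.
  onPath-codes : Fin m → Fin k → Fin 3 → ℕ
  onPath-codes q zero    = Vec.lookup (toℕ q ℕ./ d ∷ pred (toℕ q ℕ./ d) ∷ suc (code (onPath q zero)) ∷ [])
  onPath-codes q (suc l) = Vec.lookup (0 ∷ pred (code (onPath q (suc l))) ∷ suc (code (onPath q (suc l))) ∷ [])

  centre-neighbour : ∀ i {b} → Adj (centre i) b → ∃ λ j → code b ≡ centre-codes i j
  centre-neighbour i (inj₁ (attach {q = q} lower upper)) =
    fromℕ< offset<1+d , cong (λ n → t + (k * n + 0)) (begin
      toℕ q                                        ≡⟨ sym (m+[n∸m]≡n lower) ⟩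
      toℕ i * d + (toℕ q ∸ toℕ i * d)              ≡⟨ cong (_+_ (toℕ i * d)) (sym (toℕ-fromℕ< offset<1+d)) ⟩
      toℕ i * d + toℕ (fromℕ< offset<1+d)                ∎)
    where
    open ≡-Reasoning
    offset<1+d : toℕ q ∸ toℕ i * d < suc d
    offset<1+d = s≤s (≤-trans (∸-monoˡ-≤ (toℕ i * d) upper) (≤-reflexive (m+n∸m≡n (toℕ i * d) d)))

  code-step : ∀ q {l l′} → toℕ l′ ≡ suc (toℕ l) → code (onPath q l′) ≡ suc (code (onPath q l))
  code-step q {l} eq rewrite eq = trans (cong (_+_ t) (+-suc (k * toℕ q) (toℕ l))) (+-suc t _)

  -- Dividing both bounds by `d` gives `i ≤ n / d ≤ 1 + i`, so at most two centres meet a given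
  -- path.
  n/d∈ : ∀ i n → i * d ≤ n → n ≤ i * d + d → i ≡ n ℕ./ d ⊎ i ≡ pred (n ℕ./ d)
  n/d∈ i n lower upper with m≤n⇒m<n∨m≡n i≤n/d
    where
    i≤n/d : i ≤ n ℕ./ d
    i≤n/d = ≤-trans (≤-reflexive (sym (ℕ.m*n/n≡m i d))) (ℕ./-monoˡ-≤ d lower)
  ... | inj₂ i≡n/d = inj₁ i≡n/d
  ... | inj₁ i<n/d = inj₂ (cong pred (≤-antisym i<n/d (≤-trans (ℕ./-monoˡ-≤ d upper)
      (≤-reflexive (trans (cong (ℕ._/ d) (+-comm (i * d) d)) (ℕ.m*n/n≡m (suc i) d))))))

  onPath-neighbour : ∀ q l {b} → Adj (onPath q l) b → ∃ λ j → code b ≡ onPath-codes q l j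
  onPath-neighbour q zero    (inj₁ (step eq)) = suc (suc zero) , code-step q eq
  onPath-neighbour q (suc l) (inj₁ (step eq)) = suc (suc zero) , code-step q eq
  onPath-neighbour q (suc l) (inj₂ (step eq)) = suc zero , sym (cong pred (code-step q eq))
  onPath-neighbour q zero    (inj₂ (attach {i} lower upper)) with n/d∈ (toℕ i) (toℕ q) lower upper
  ... | inj₁ eq = zero , eq
  ... | inj₂ eq = suc zero , eq

  decode-degree≤ : ∀ x a → decode x ≡ a → degree graph x ≤ suc d
  decode-degree≤ x (centre i)   eq = degree≤ graph x (centre-codes i) λ y x~y →
    let j , c = centre-neighbour i (subst (λ a → Adj a (decode y)) eq x~y) in j , trans (toℕ≡code y) c
  decode-degree≤ x (onPath q l) eq = ≤-trans
    (degree≤ graph x (onPath-codes q l) λ y x~y →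
      let j , c = onPath-neighbour q l (subst (λ a → Adj a (decode y)) eq x~y) in j , trans (toℕ≡code y) c)
    -- A path vertex has at most three neighbours, and `3 ≤ s` is used here.
    (s≤s 2≤d)

  graph-degree≤ : ∀ x → degree graph x ≤ suc d
  graph-degree≤ x = decode-degree≤ x (decode x) refl

  -- Lower bound: a packing with one tree per centre.

  spine : Fin t → Fin (suc k) → V
  spine i zero    = centre i
  spine i (suc l) = onPath (anchor i) l

  spine-mono : ∀ i {a b} → a Fin.< b → code (spine i a) < code (spine i b)
  spine-mono i {zero}  {suc b} _     = centre<onPath i (anchor i) b
  spine-mono i {suc a} {suc b} a<b = onPath-mono (anchor i) (ℕ.s<s⁻¹ a<b)

  spine-adjacent : ∀ i j → spine i (inject₁ j) ⋖ spine i (suc j)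
  spine-adjacent i zero    = centre⋖anchor i
  spine-adjacent i (suc j) = step-inject₁ (anchor i) j

  spine-disjoint : ∀ {i j} a b → spine i a ≡ spine j b → i ≡ j
  spine-disjoint zero    zero    refl = refl
  spine-disjoint zero    (suc b) ()
  spine-disjoint (suc a) zero    ()
  spine-disjoint (suc a) (suc b) eq   = anchor-injective (onPath-injectiveˡ eq)
    where
    onPath-injectiveˡ : ∀ {q q′ l l′} → _≡_ {A = V} (onPath q l) (onPath q′ l′) → q ≡ q′
    onPath-injectiveˡ refl = refl

  encode-injective : Injective _≡_ _≡_ encode
  encode-injective {a} {b} eq = trans (sym (decode-encode a)) (trans (cong decode eq) (decode-encode b))

  module Spine (i : Fin t) =
    IncreasingPath graph (encode ∘ spine i)
      (λ {a} {b} a<b → encode-mono (spine i a) (spine i b) (spine-mono i a<b))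
      (Adj⇒~ ∘ inj₁ ∘ spine-adjacent i)

  spines : TreePacking k graph t
  spines = Spine.path , (λ i → Spine.path-isTree i , Spine.edgeCount-path i) , disjoint
    where
    disjoint : ∀ i j → i ≢ j → _
    disjoint i j i≢j (x , x∈) with x∈p∩q⁻ (vertices (Spine.path i)) (vertices (Spine.path j)) x∈
    ... | x∈i , x∈j with Spine.∈path⇒w i x∈i | Spine.∈path⇒w j x∈j
    ... | a , eq | b , eq′ = i≢j (spine-disjoint a b (encode-injective (trans eq (sym eq′))))

  -- Upper bound: every tree uses up a centre.

  -- A connected subgraph avoiding all centres stays on one path and has fewer than k edges.
  tree-contains-centre : (T : Subgraph graph) → IsTree T → edgeCount T ≡ k →
    ∃ λ i → encode (centre i) ∈ vertices T
  tree-contains-centre T (((x₀ , x₀∈) , connected) , _) count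
    with any? (λ i → encode (centre i) ∈? vertices T)
  ... | yes found = found
  -- A path has `k′` edges, one fewer than `k`; `s≤s` turns the bound by `k′` into a strict bound by
  -- `k`.
  ... | no ¬centre = contradiction count (<⇒≢ (s≤s (edgeCount≤ T path-edge edge-position)))
    where
    open Subgraph T using (edge; edge-sym; edge⇒~; edge⇒∈)

    avoids : ∀ {x i} → x ∈ vertices T → decode x ≢ centre i
    avoids x∈ eq = ¬centre (_ , subst (_∈ vertices T) (encode≡ eq) x∈)

    start : ∃ λ q → ∃ λ l → decode x₀ ≡ onPath q l
    start with decode x₀ in eq
    ... | centre i   = contradiction eq (avoids x₀∈)
    ... | onPath q l = q , l , refl

    q₀ = proj₁ start

    On : Fin size → Set
    On x = ∃ λ l → decode x ≡ onPath q₀ l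

    -- Edges that leave a path end in centres, which `T` avoids.
    On-edge : ∀ {x y} → On x → edge x y → On y
    On-edge {x} {y} (l , eq) Exy with decode y in eq′ | subst (λ a → Adj a (decode y)) eq (edge⇒~ Exy)
    ... | centre i     | _               = contradiction eq′ (avoids (edge⇒∈ (edge-sym Exy)))
    ... | onPath _ l′  | inj₁ (step _)   = l′ , refl
    ... | onPath _ l′  | inj₂ (step _)   = l′ , refl

    On-walk : ∀ {x y} → Star edge x y → On x → On y
    On-walk ε          on = on
    On-walk (e ◅ walk) on = On-walk walk (On-edge on e)

    path-edge : Fin k′ → Fin size × Fin size
    path-edge j = encode (onPath q₀ (inject₁ j)) , encode (onPath q₀ (suc j))

    edge-position : ∀ x y → x Fin.< y → edge x y → ∃ λ j → (x , y) ≡ path-edge j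
    edge-position x y x<y Exy
      with On-walk (connected x₀∈ (edge⇒∈ Exy)) (proj₂ start)
         | On-walk (connected x₀∈ (edge⇒∈ (edge-sym Exy))) (proj₂ start)
    -- Since `x < y`, the edge is oriented from `x` to `y` and can only be a `step`. Its upper end
    -- is therefore not at position zero, and `suc j` there forces `inject₁ j` at the lower end.
    ... | l , eqx | l′ , eqy with l′ | eqy | subst₂ _⋖_ eqx eqy (<⇒⋖ x<y (edge⇒~ Exy))
    ... | suc j | eqy′ | step eq = j , cong₂ _,_
      (trans (encode≡ eqx) (cong (encode ∘ onPath q₀)
        (toℕ-injective (trans (sym (ℕ.suc-injective eq)) (sym (toℕ-inject₁ j))))))
      (encode≡ eqy′)

  -- A centre chosen from each tree determines the tree, since distinct trees are disjoint; so the
  -- trees inject into the centres.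
  packing≤ : ∀ t″ → TreePacking k graph t″ → t″ ≤ t
  packing≤ t″ (T , trees , disjoint) = Fin.injective⇒≤ {f = centre-of} centre-of-injective
    where
    contains : ∀ i → ∃ λ j → encode (centre j) ∈ vertices (T i)
    contains i = uncurry (tree-contains-centre (T i)) (trees i)

    centre-of : Fin t″ → Fin t
    centre-of i = proj₁ (contains i)

    centre-of-injective : Injective _≡_ _≡_ centre-of
    centre-of-injective {i} {j} eq with i Fin.≟ j
    ... | yes i≡j = i≡j
    ... | no i≢j  = contradiction
      (_ , x∈p∩q⁺ (proj₂ (contains i) ,
        subst (λ c → encode (centre c) ∈ vertices (T j)) (sym eq) (proj₂ (contains j))))
      (disjoint i j i≢j)

  τ-graph : τ k ⟨ graph ⟩≐ t
  τ-graph = spines , packing≤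

  -- Numbers of vertices and the infinite family.

  -- This isolates the denominator of the claimed ratio: for `s = 1 + d` the factor `suc (d * k)` is
  -- `s k - k + 1`.
  size≡ : size ≡ t * suc (d * k) + k
  size≡ = solve 3 (λ t d k → t :+ (con 1 :+ t :* d) :* k := t :* (con 1 :+ d :* k) :+ k) refl t d k
    where open +-*-Solver

  -- Besides `v ≢ k`, this makes truncated subtraction of `k` agree with integer subtraction.
  k<size : k < size
  k<size = s≤s (≤-trans (m≤m+n k _) (m≤n+m _ t′))

-- As a function of the number of centres the number of vertices is strictly increasing, and this
-- alone separates the isomorphism classes.
order : ℕ → ℕ → ℕ → ℕ
order d k t = t + suc (t * d) * k

order-mono-< : ∀ d k {t t′} → t < t′ → order d k t < order d k t′
order-mono-< d k t<t′ = +-mono-<-≤ t<t′ (*-monoˡ-≤ k (s≤s (*-monoˡ-≤ d (<⇒≤ t<t′))))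

≅⇒v≡ : ∀ {G H} → G ≅ H → v G ≡ v H
≅⇒v≡ iso = ↔⇒≡ (_≅_.bij iso)

theorem1p10 : ∀ (s k : ℕ) → 3 ≤ s → 2 ≤ k →
    Σ[ G ∈ (ℕ → Graph) ]
    (∀ i → Connected (G i) × 𝒢 1 s (G i) × v (G i) ≢ k ×
    (∃[ t ] (τ k ⟨ G i ⟩≐ t) × ((+ t) / 1 ≡ (+ v (G i) - + k) / suc (s * k ∸ k)))) ×
    (∀ i j → i ≢ j → ¬ (G i ≅ G j))
theorem1p10 (suc d) (suc k′) (s≤s 2≤d) _ = (λ i → C.graph i) , properties , distinct
  where
  -- The graph with index `i` has `suc i` centres, so there is always at least one.
  module C (t′ : ℕ) = Caterpillar d k′ t′ 2≤d
  k = suc k′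

  ratio : ∀ i → (+ suc i) / 1 ≡ (+ v (C.graph i) - + k) / suc (suc d * k ∸ k)
  -- The normalised fractions are compared by cross-multiplying unnormalised ones. `mkℚᵘ` takes the
  -- denominator minus one, so `0` stands for denominator one.
  ratio i = ℚ.fromℚᵘ-cong {ℚᵘ.mkℚᵘ (+ suc i) 0} {ℚᵘ.mkℚᵘ (+ v (C.graph i) - + k) (suc d * k ∸ k)} (ℚᵘ.*≡* (begin
    + suc i ℤ.* + suc (suc d * k ∸ k)            ≡⟨ cong (λ n → + suc i ℤ.* + suc n) (m+n∸m≡n k (d * k)) ⟩
    + suc i ℤ.* + suc (d * k)                    ≡⟨ sym (ℤ.pos-* (suc i) (suc (d * k))) ⟩
    + (suc i * suc (d * k))                      ≡⟨ cong +_ (sym (m+n∸n≡m (suc i * suc (d * k)) k)) ⟩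
    + (suc i * suc (d * k) + k ∸ k)              ≡⟨ cong (λ n → + (n ∸ k)) (sym (C.size≡ i)) ⟩
    + (v (C.graph i) ∸ k)                        ≡⟨ sym (ℤ.⊖-≥ (<⇒≤ (C.k<size i))) ⟩
    v (C.graph i) ℤ.⊖ k                          ≡⟨ sym (ℤ.m-n≡m⊖n (v (C.graph i)) k) ⟩
    + v (C.graph i) - + k                        ≡⟨ sym (ℤ.*-identityʳ _) ⟩
    (+ v (C.graph i) - + k) ℤ.* + 1              ∎))
    where open ≡-Reasoning

  properties = λ i →
    C.graph-connected i ,
    (λ x → C.graph-degree≥1 i x , C.graph-degree≤ i x) ,
    >⇒≢ (C.k<size i) ,
    suc i , C.τ-graph i , ratio i

  distinct : ∀ i j → i ≢ j → ¬ (C.graph i ≅ C.graph j)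
  distinct i j i≢j iso with <-cmp i j
  ... | tri< i<j _ _ = <⇒≢ (order-mono-< d k (s<s i<j)) (≅⇒v≡ iso)
  ... | tri≈ _ i≡j _ = i≢j i≡j
  ... | tri> _ _ j<i = >⇒≢ (order-mono-< d k (s<s j<i)) (≅⇒v≡ iso)
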